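{- The problem PPT (defined in the context) is decidable for correlation-free cellular automata (CFCA) of dimension $1$ when the threshold function $\vartheta$ satisfies $\vartheta(n)=\alpha\lambda^n$ for some $\alpha>0$ and $\lambda<1$, which may depend on the CFCA.
   Context: A (one-dimensional) stochastic cellular automaton (CA) is a tuple $(Q,R,V,V',f)$ where $Q$ (states) and $R$ (random symbols) are finite sets, $V=\{v_1,\dots,v_\rho\}$ and $V'=\{v'_1,\dots,v'_{\rho'}\}$ are finite subsets of $\mathbb{Z}$, and $f:Q^\rho\times R^{\rho'}\to Q$. It is a correlation-free CA (CFCA) if $V'=\{0\}$. It is identified with its explicit global function $F:Q^{\mathbb{Z}}\times R^{\mathbb{Z}}\to Q^{\mathbb{Z}}$, $F(c,s)_z=f\big((c_{z+v_j})_j,(s_{z+v'_j})_j\big)$. For $c\in Q^{\mathbb{Z}}$, $\mathcal{S}_F(c)$ is the law of $F(c,s)$ when $s$ is drawn from the uniform (i.i.d. uniform product) measure on $R^{\mathbb{Z}}$. For a finite word $u$ with letters $u_0,\dots,u_{|u|-1}$ and $z\in\mathbb{Z}$, $[u]_z=\{c: c_{z+x}=u_x \text{ for all } 0\le x<|u|\}$. Problem PPT (Pattern Probability Threshold). Input: a stochastic CA $F$ over a state set $Q$ with $|Q|\ge 4$, three distinguished distinct symbols $x,y,z\in Q$, and a threshold function $\vartheta:\mathbb{N}\to[0,1]$. Question: is there a configuration $c$ and $n\ge1$ such that $\big(\mathcal{S}_F(c)\big)([x\cdot y^n\cdot z]_0)>\vartheta(n)$? "PPT for CFCA" means that the input CA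 is restricted to be a CFCA.
   Formalization: The numbers α, λ and the values of ϑ are taken in an arbitrary Archimedean ordered field with decidable order (such as the rationals or the real algebraic numbers), since for a noncomputable real λ the problem is undecidable. -}

module Defs where

open import Algebra.Bundles using (CommutativeRing; Semiring)
import Algebra.Definitions.RawSemiring as RawSemiringDefinitions
open import Data.Fin.Base using (Fin; toℕ; fromℕ<)
import Data.Fin.Properties as Fin
open import Data.Integer.Base as ℤ using (ℤ; +_; -[1+_]; 0ℤ; ∣_∣)
import Data.Integer.Properties as ℤ
open import Data.List.Base using (List; []; _∷_; length; filter; allFin; cartesianProductWith)
open import Data.Nat.Base as ℕ using (ℕ; zero; suc; NonZero)
import Data.Nat.Properties as ℕ
open import Data.Product.Base using (∃-syntax; _×_)
open import Data.Sum.Base using (_⊎_)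
open import Data.Vec.Base as Vec using (Vec; []; _∷_; _∷ʳ_; lookup)
open import Data.Vec.Membership.Propositional using (_∈_)
open import Data.Vec.Relation.Unary.Any using (here; there)
open import Data.Vec.Relation.Unary.Unique.Propositional using (Unique)
open import Function.Bundles using (_⇔_)
open import Level using (Level; _⊔_) renaming (suc to lsuc)
open import Relation.Binary.Core using (Rel)
open import Relation.Binary.PropositionalEquality
open import Relation.Binary.Structures using (IsStrictTotalOrder)
open import Relation.Nullary.Negation.Core using (¬_)
open import Relation.Unary using (Pred; Decidable)

------------------------------------------------------------------------
-- Exact real numbers

-- An Archimedean ordered field with decidable order. Classically these are,
-- up to isomorphism, exactly the subfields of ℝ, given here with an exact
-- comparison (ℚ, the real algebraic numbers, …). Reals that are inputs of
-- a decision problem are taken in such a field, since comparing arbitrary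
-- reals is not computable.

record ExactReals (a ℓ₁ ℓ₂ : Level) : Set (lsuc (a ⊔ ℓ₁ ⊔ ℓ₂)) where
  field
    commutativeRing : CommutativeRing a ℓ₁

  open CommutativeRing commutativeRing public
  open RawSemiringDefinitions (Semiring.rawSemiring semiring) public
    using (_^_) renaming (_×_ to _·_)

  infix 4 _<_ _≤_
  infix 8 _⁻¹

  field
    _<_                : Rel Carrier ℓ₂
    isStrictTotalOrder : IsStrictTotalOrder _≈_ _<_
    +-monoˡ-<          : ∀ z {x y} → x < y → x + z < y + z
    *-pos              : ∀ {x y} → 0# < x → 0# < y → 0# < x * y
    1≉0                : ¬ (1# ≈ 0#)
    -- Total for convenience: the value of 0# ⁻¹ is unconstrained.
    _⁻¹                : Carrier → Carrier
    *-inverseʳ         : ∀ {x} → ¬ (x ≈ 0#) → x * x ⁻¹ ≈ 1#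
    archimedean        : ∀ x → ∃[ n ] x < n · 1#

  _≤_ : Rel Carrier (ℓ₁ ⊔ ℓ₂)
  x ≤ y = x < y ⊎ x ≈ y

------------------------------------------------------------------------
-- The uniform measure on (Fin r)^ℤ, on events that depend on finitely many
-- coordinates

words : ∀ r n → List (Vec (Fin r) n)
words r zero    = [] ∷ []
words r (suc n) = cartesianProductWith _∷_ (allFin r) (words r n)

record LocalEvent (r : ℕ) : Set₁ where
  field
    Holds  : Pred (ℤ → Fin r) _
    holds? : Decidable Holds
    start  : ℤ
    width  : ℕ
    local  : ∀ s s′ →
             (∀ i → start ℤ.≤ i → i ℤ.< start ℤ.+ + width → s i ≡ s′ i) →
             Holds s → Holds s′

module _ {r : ℕ} .{{_ : NonZero r}} where

  defaultSymbol : Fin r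
  defaultSymbol = fromℕ< (ℕ.>-nonZero⁻¹ r)

  nth : ∀ {n} → Vec (Fin r) n → ℕ → Fin r
  nth []      _       = defaultSymbol
  nth (a ∷ w) zero    = a
  nth (a ∷ w) (suc k) = nth w k

  -- The word w written at positions start, start + 1, …; the filler used
  -- elsewhere is irrelevant to an event local to that window.
  place : ∀ {n} → ℤ → Vec (Fin r) n → ℤ → Fin r
  place start w i with i ℤ.- start
  ... | + k      = nth w k
  ... | -[1+ _ ] = defaultSymbol

  -- A local event is the disjoint union of the cylinders [w]_start over the
  -- words w satisfying it, each of which has measure r ^ (- width).
  uniform : ∀ {a ℓ₁ ℓ₂} (K : ExactReals a ℓ₁ ℓ₂) →
            LocalEvent r → ExactReals.Carrier K
  uniform K E =
    (length (filter (λ w → holds? (place start w)) (words r width)) · 1#)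
      * ((r ℕ.^ width) · 1#) ⁻¹
    where
    open ExactReals K
    open LocalEvent E

------------------------------------------------------------------------
-- Stochastic cellular automata

-- Q = Fin q and R = Fin r. R is nonempty since R^ℤ carries a uniform
-- probability measure.

record StochasticCA : Set where
  field
    q r ρ ρ′    : ℕ
    .{{r-nonZero}} : NonZero r
    V           : Vec ℤ ρ
    V-unique    : Unique V
    V′          : Vec ℤ ρ′
    V′-unique   : Unique V′
    f           : Vec (Fin q) ρ → Vec (Fin r) ρ′ → Fin q

  Q R : Set
  Q = Fin q
  R = Fin r

  globalMap : (ℤ → Q) → (ℤ → R) → (ℤ → Q)
  globalMap c s z = f (Vec.map (λ v → c (z ℤ.+ v)) V)
                      (Vec.map (λ v → s (z ℤ.+ v)) V′)

  CorrelationFree : Set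
  CorrelationFree = ∀ z → z ∈ V′ ⇔ z ≡ 0ℤ

-- The cylinder [u]_z.
Cylinder : ∀ {q n} → Vec (Fin q) n → ℤ → Pred (ℤ → Fin q) _
Cylinder {n = n} u z c = ∀ (x : Fin n) → c (z ℤ.+ + toℕ x) ≡ lookup u x

maxAbs : ∀ {n} → Vec ℤ n → ℕ
maxAbs []      = 0
maxAbs (v ∷ V) = ∣ v ∣ ℕ.⊔ maxAbs V

∈⇒∣∣≤maxAbs : ∀ {n v} {V : Vec ℤ n} → v ∈ V → ∣ v ∣ ℕ.≤ maxAbs V
∈⇒∣∣≤maxAbs (here refl)            = ℕ.m≤m⊔n _ _
∈⇒∣∣≤maxAbs {V = w ∷ _} (there v∈V) =
  ℕ.≤-trans (∈⇒∣∣≤maxAbs v∈V) (ℕ.m≤n⊔m ∣ w ∣ _)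

map-cong-∈ : ∀ {A B : Set} {n} {g h : A → B} (xs : Vec A n) →
             (∀ {x} → x ∈ xs → g x ≡ h x) → Vec.map g xs ≡ Vec.map h xs
map-cong-∈ []       eq = refl
map-cong-∈ (x ∷ xs) eq =
  cong₂ _∷_ (eq (here refl)) (map-cong-∈ xs (λ x∈ → eq (there x∈)))

module _ (F : StochasticCA) where
  open StochasticCA F

  -- The event F(c,s) ∈ [u]_z in the random configuration s. It depends only
  -- on s at the positions from z - m to z + |u| + m - 1, where m = max |V′|.
  cylinderPreimage : ∀ {n} → (ℤ → Q) → Vec Q n → ℤ → LocalEvent r
  cylinderPreimage {n} c u z = record
    { Holds  = λ s → Cylinder u z (globalMap c s)
    ; holds? = λ s → Fin.all? (λ x → globalMap c s (z ℤ.+ + toℕ x) Fin.≟ lookup u x)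
    ; start  = start
    ; width  = m ℕ.+ (n ℕ.+ m)
    ; local  = λ s s′ agree holds x →
        trans (cong (f _) (map-cong-∈ V′ (λ v∈ →
                 sym (agree _ (lower x v∈) (upper x v∈)))))
              (holds x)
    }
    where
    m = maxAbs V′
    start = z ℤ.- + m

    lower : ∀ {v} (x : Fin n) → v ∈ V′ → start ℤ.≤ z ℤ.+ + toℕ x ℤ.+ v
    lower {v} x v∈ = begin
      z ℤ.- + m             ≤⟨ ℤ.+-mono-≤ (ℤ.i≤i+j z (+ toℕ x)) -m≤v ⟩
      z ℤ.+ + toℕ x ℤ.+ v   ∎
      where
      open ℤ.≤-Reasoning hiding (start)
      -m≤v : ℤ.- + m ℤ.≤ v
      -m≤v = ℤ.≤-trans (ℤ.neg-mono-≤ (ℤ.+≤+ (∈⇒∣∣≤maxAbs v∈))) (-∣∣≤ v)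
        where
        -∣∣≤ : ∀ i → ℤ.- + ∣ i ∣ ℤ.≤ i
        -∣∣≤ (+ k)    = ℤ.≤-trans (ℤ.neg-mono-≤ (ℤ.+≤+ ℕ.z≤n)) (ℤ.+≤+ ℕ.z≤n)
        -∣∣≤ -[1+ k ] = ℤ.≤-refl

    upper : ∀ {v} (x : Fin n) → v ∈ V′ →
            z ℤ.+ + toℕ x ℤ.+ v ℤ.< start ℤ.+ + (m ℕ.+ (n ℕ.+ m))
    upper {v} x v∈ = begin-strict
      z ℤ.+ + toℕ x ℤ.+ v               <⟨ ℤ.+-mono-<-≤ (ℤ.+-monoʳ-< z (ℤ.+<+ (Fin.toℕ<n x))) v≤m ⟩
      z ℤ.+ + n ℤ.+ + m                 ≡⟨ ℤ.+-assoc z (+ n) (+ m) ⟩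
      z ℤ.+ + (n ℕ.+ m)                 ≡⟨ cong (ℤ._+ + (n ℕ.+ m)) z≡ ⟩
      start ℤ.+ + m ℤ.+ + (n ℕ.+ m)     ≡⟨ ℤ.+-assoc start (+ m) (+ (n ℕ.+ m)) ⟩
      start ℤ.+ + (m ℕ.+ (n ℕ.+ m))     ∎
      where
      open ℤ.≤-Reasoning hiding (start)
      v≤m : v ℤ.≤ + m
      v≤m = ℤ.≤-trans (≤∣∣ v) (ℤ.+≤+ (∈⇒∣∣≤maxAbs v∈))
        where
        ≤∣∣ : ∀ i → i ℤ.≤ + ∣ i ∣
        ≤∣∣ (+ k)    = ℤ.≤-refl
        ≤∣∣ -[1+ k ] = ℤ.-≤+
      z≡ : z ≡ start ℤ.+ + m
      z≡ = sym (trans (ℤ.+-assoc z (ℤ.- + m) (+ m))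
                 (trans (cong (λ i → z ℤ.+ i) (ℤ.+-inverseˡ (+ m))) (ℤ.+-identityʳ z)))

  -- (𝒮_F(c))([u]_z): the law of F(c,s) is the image of the uniform measure.
  law : ∀ {a ℓ₁ ℓ₂} (K : ExactReals a ℓ₁ ℓ₂) {n : ℕ} →
        (ℤ → Q) → Vec Q n → ℤ → ExactReals.Carrier K
  law K c u z = uniform K (cylinderPreimage c u z)

------------------------------------------------------------------------
-- Pattern Probability Threshold

module _ {a ℓ₁ ℓ₂} (K : ExactReals a ℓ₁ ℓ₂) where
  open ExactReals K

  record PPTInput : Set (a ⊔ ℓ₁ ⊔ ℓ₂) where
    field
      F : StochasticCA
    open StochasticCA F
    field
      4≤∣Q∣ : 4 ℕ.≤ q
      x y z : Q
      x≢y   : ¬ (x ≡ y)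
      y≢z   : ¬ (y ≡ z)
      x≢z   : ¬ (x ≡ z)
      ϑ     : ℕ → Carrier
      0≤ϑ   : ∀ n → 0# ≤ ϑ n
      ϑ≤1   : ∀ n → ϑ n ≤ 1#

  PPT : PPTInput → Set ℓ₂
  PPT I = ∃[ c ] ∃[ n ] 1 ℕ.≤ n × ϑ n < law F K c (x ∷ (Vec.replicate n y ∷ʳ z)) 0ℤ
    where open PPTInput I

{-# OPTIONS --safe #-}
module Submission where

-- In a correlation-free automaton distinct sites use distinct random
-- symbols, so the probability of writing x y ^ n z is the product of the
-- probabilities of writing the single letters, each of which depends on the
-- configuration in one neighbourhood only (count-writes, law-weight).
-- Multiplied by r ^ (n + 2), where r is the number of random symbols, this
-- probability is a product of natural numbers, the weights of the sites, and
-- the threshold α λ ^ n becomes (α r ^ 2) (λ r) ^ n. With α and λ standing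
-- for the scaled constants from now on, it remains to decide whether some
-- configuration has, for some n, a total weight above α λ ^ n.
--
-- A configuration is a walk in the graph of windows of M letters, where M + 1
-- letters cover the neighbourhood of a site, and its weight is the product of
-- the weights of the edges. There are only N = q ^ M windows, so a walk with
-- n > N passes twice through the same window within its first N steps
-- (findCycle), and the part between the two visits is a cycle of some length
-- ℓ. If the weight of the cycle is at most λ ^ ℓ, then cutting it out leaves
-- a shorter walk whose weight is above its own threshold (remove-cycle). If
-- it is larger than λ ^ ℓ, then repeating it gains against the threshold by a
-- constant factor larger than 1 each time, so by Bernoulli's inequality and
-- the Archimedean property enough repetitions exceed the threshold, as long
-- as the walks into and out of the cycle have positive weight
-- (geometric-overtakes, repeat-cycle). Hence the answer is positive exactly
-- if there is a walk above the threshold with n at most N, or such a cycle,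
-- called a lasso below, at a bounded distance from the start and of bounded
-- length (exceeds⇒short⊎lasso, lasso⇒exceeds). Whether a lasso can leave its
-- cycle with positive weight is again a matter of walks of length at most N,
-- by cutting out cycles (completeShortly). Both alternatives concern boundedly
-- many letters and can be decided by exhaustive search (anyStream?).

open import Defs
import Algebra.Properties.CommutativeSemiring.Exp
import Algebra.Properties.Ring
import Algebra.Properties.Semiring.Exp
import Algebra.Properties.Semiring.Mult
import Algebra.Solver.Ring.NaturalCoefficients.Default
open import Data.Fin.Base using (Fin; toℕ; fromℕ<; funToFin; finToFun)
import Data.Fin.Properties as Fin
open import Data.Integer.Base as ℤ using (ℤ; +_; -[1+_]; 0ℤ; ∣_∣)
import Data.Integer.Properties as ℤ
open import Data.List.Base as List
  using (List; []; _∷_; length; filter; allFin; cartesianProductWith)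
import Data.List.Properties as List
import Data.List.Relation.Unary.All as All using (universal)
import Data.List.Relation.Unary.All.Properties as All using (map⁺)
open import Data.Nat.Base as ℕ using (ℕ; zero; suc; NonZero; s≤s; z≤n)
open import Data.Nat.Induction using (Acc; acc; <-wellFounded)
import Data.Nat.Properties as ℕ
import Data.Nat.Solver
open import Data.Product.Base using (_×_; _,_; proj₁; proj₂; ∃; ∃-syntax)
open import Data.Sum.Base using (_⊎_; inj₁; inj₂)
open import Data.Vec.Base as Vec using (Vec; []; _∷_; _∷ʳ_; lookup)
open import Data.Vec.Membership.Propositional using (_∈_)
open import Data.Vec.Relation.Unary.Any using (here; there)
open import Function.Base using (_∘_)
open import Function.Bundles using (_⇔_; mk⇔; Equivalence)
open import Relation.Binary.Bundles using (StrictPartialOrder)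
open import Relation.Binary.Definitions using (tri<; tri≈; tri>)
open import Relation.Binary.PropositionalEquality as ≡ using (_≡_)
import Relation.Binary.Reasoning.StrictPartialOrder
open import Relation.Binary.Structures using (IsStrictTotalOrder)
open import Relation.Nullary.Decidable.Core using (Dec; yes; no; map′; _×-dec_; _⊎-dec_)
open import Relation.Nullary.Negation.Core using (¬_; contradiction)
open import Relation.Unary using (Pred; Decidable)

-- Archimedean ordered fields.

module OrderedField {a ℓ₁ ℓ₂} (K : ExactReals a ℓ₁ ℓ₂) where
  open ExactReals K
  open Algebra.Properties.Ring ring using (-‿distribˡ-*; -‿involutive)
  open Algebra.Properties.Semiring.Mult semiring using (×1-homo-*)
  open Algebra.Properties.Semiring.Exp semiring using (^-congˡ)
  open Algebra.Solver.Ring.NaturalCoefficients.Default commutativeSemiring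
    using (solve; _:*_; _:+_; _:=_)
  open IsStrictTotalOrder isStrictTotalOrder public
    using (compare; _<?_)
    renaming (irrefl to <-irrefl; trans to <-trans; <-respˡ-≈ to <-respˡ; <-respʳ-≈ to <-respʳ)

  strictPartialOrder : StrictPartialOrder a ℓ₁ ℓ₂
  strictPartialOrder = record
    { isStrictPartialOrder = IsStrictTotalOrder.isStrictPartialOrder isStrictTotalOrder }

  open Relation.Binary.Reasoning.StrictPartialOrder strictPartialOrder public hiding (start)

  ≤⇒≯ : ∀ {x y} → x ≤ y → ¬ (y < x)
  ≤⇒≯ (inj₁ x<y) y<x = <-irrefl refl (<-trans x<y y<x)
  ≤⇒≯ (inj₂ x≈y) y<x = <-irrefl (sym x≈y) y<x

  ≮⇒≥ : ∀ {x y} → ¬ (x < y) → y ≤ x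
  ≮⇒≥ {x} {y} x≮y with compare x y
  ... | tri< x<y _ _ = contradiction x<y x≮y
  ... | tri≈ _ x≈y _ = inj₂ (sym x≈y)
  ... | tri> _ _ y<x = inj₁ y<x

  x-y+y≈x : ∀ x y → (x + - y) + y ≈ x
  x-y+y≈x x y = trans (+-assoc x (- y) y) (trans (+-congˡ (-‿inverseˡ y)) (+-identityʳ x))

  x<y⇒0<y-x : ∀ {x y} → x < y → 0# < y + - x
  x<y⇒0<y-x {x} x<y = <-respˡ (-‿inverseʳ x) (+-monoˡ-< (- x) x<y)

  0<1 : 0# < 1#
  0<1 with compare 0# 1#
  ... | tri< 0<1 _ _ = 0<1
  ... | tri≈ _ 0≈1 _ = contradiction (sym 0≈1) 1≉0
  ... | tri> _ _ 1<0 = <-respʳ -1*-1≈1 (*-pos 0<-1 0<-1)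
    where
    0<-1 : 0# < - 1#
    0<-1 = <-respʳ (+-identityˡ _) (x<y⇒0<y-x 1<0)
    -1*-1≈1 : - 1# * - 1# ≈ 1#
    -1*-1≈1 = trans (sym (-‿distribˡ-* 1# (- 1#)))
                (trans (-‿cong (*-identityˡ (- 1#))) (-‿involutive 1#))

  *-monoˡ-< : ∀ {x y z} → 0# < z → x < y → x * z < y * z
  *-monoˡ-< {x} {y} {z} 0<z x<y = begin-strict
    x * z                        ≈⟨ +-identityˡ (x * z) ⟨
    0# + x * z                   <⟨ +-monoˡ-< (x * z) (*-pos (x<y⇒0<y-x x<y) 0<z) ⟩
    (y + - x) * z + x * z        ≈⟨ distribʳ z (y + - x) x ⟨
    ((y + - x) + x) * z          ≈⟨ *-congʳ (x-y+y≈x y x) ⟩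
    y * z                        ∎

  *-monoˡ-≤ : ∀ {x y z} → 0# ≤ z → x ≤ y → x * z ≤ y * z
  *-monoˡ-≤ (inj₁ 0<z) (inj₁ x<y) = inj₁ (*-monoˡ-< 0<z x<y)
  *-monoˡ-≤ {x} {y} (inj₂ 0≈z) _  =
    inj₂ (trans (*-congˡ (sym 0≈z)) (trans (trans (zeroʳ x) (sym (zeroʳ y))) (*-congˡ 0≈z)))
  *-monoˡ-≤ _ (inj₂ x≈y)          = inj₂ (*-congʳ x≈y)

  *-monoʳ-≤ : ∀ {x y z} → 0# ≤ z → x ≤ y → z * x ≤ z * y
  *-monoʳ-≤ {x} {y} {z} 0≤z x≤y = begin
    z * x  ≈⟨ *-comm z x ⟩
    x * z  ≤⟨ *-monoˡ-≤ 0≤z x≤y ⟩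
    y * z  ≈⟨ *-comm y z ⟩
    z * y  ∎

  *-nonNeg : ∀ {x y} → 0# ≤ x → 0# ≤ y → 0# ≤ x * y
  *-nonNeg {x} {y} 0≤x 0≤y = begin
    0#      ≈⟨ zeroˡ y ⟨
    0# * y  ≤⟨ *-monoˡ-≤ 0≤y 0≤x ⟩
    x * y   ∎

  *-cancelʳ-< : ∀ {x y z} → 0# ≤ z → x * z < y * z → x < y
  *-cancelʳ-< {x} {y} 0≤z xz<yz with compare x y
  ... | tri< x<y _ _ = x<y
  ... | tri≈ _ x≈y _ = contradiction xz<yz (≤⇒≯ (*-monoˡ-≤ 0≤z (inj₂ (sym x≈y))))
  ... | tri> _ _ y<x = contradiction xz<yz (≤⇒≯ (*-monoˡ-≤ 0≤z (inj₁ y<x)))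

  +-monoʳ-< : ∀ {x y} z → x < y → z + x < z + y
  +-monoʳ-< {x} {y} z x<y = <-respˡ (+-comm x z) (<-respʳ (+-comm y z) (+-monoˡ-< z x<y))

  +-nonNeg : ∀ {x y} → 0# ≤ x → 0# ≤ y → 0# ≤ x + y
  +-nonNeg {x} {y} 0≤x (inj₂ 0≈y) = begin
    0#      ≤⟨ 0≤x ⟩
    x       ≈⟨ +-identityʳ x ⟨
    x + 0#  ≈⟨ +-congˡ 0≈y ⟩
    x + y   ∎
  +-nonNeg {x} {y} 0≤x (inj₁ 0<y) = begin
    0#      ≤⟨ 0≤x ⟩
    x       ≈⟨ +-identityʳ x ⟨
    x + 0#  <⟨ +-monoʳ-< x 0<y ⟩
    x + y   ∎

  ^-nonNeg : ∀ {x} → 0# ≤ x → ∀ n → 0# ≤ x ^ n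
  ^-nonNeg 0≤x zero    = inj₁ 0<1
  ^-nonNeg 0≤x (suc n) = *-nonNeg 0≤x (^-nonNeg 0≤x n)

  ^-pos : ∀ {x} → 0# < x → ∀ n → 0# < x ^ n
  ^-pos 0<x zero    = 0<1
  ^-pos 0<x (suc n) = *-pos 0<x (^-pos 0<x n)

  -- The embedding of the natural numbers.
  ι : ℕ → Carrier
  ι n = n · 1#

  ι-* : ∀ m n → ι (m ℕ.* n) ≈ ι m * ι n
  ι-* = ×1-homo-*

  ι-^ : ∀ m n → ι (m ℕ.^ n) ≈ ι m ^ n
  ι-^ m zero    = +-identityʳ 1#
  ι-^ m (suc n) = trans (ι-* m (m ℕ.^ n)) (*-congˡ (ι-^ m n))

  ι-nonNeg : ∀ n → 0# ≤ ι n
  ι-nonNeg zero    = inj₂ refl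
  ι-nonNeg (suc n) = +-nonNeg (inj₁ 0<1) (ι-nonNeg n)

  ι-pos : ∀ {n} → 0 ℕ.< n → 0# < ι n
  ι-pos {suc n} _ = begin-strict
    0#        ≤⟨ ι-nonNeg n ⟩
    ι n       ≈⟨ +-identityˡ (ι n) ⟨
    0# + ι n  <⟨ +-monoˡ-< (ι n) 0<1 ⟩
    1# + ι n  ∎

  ι-pos⁻¹ : ∀ {n} → 0# < ι n → 0 ℕ.< n
  ι-pos⁻¹ {zero}  0<0 = contradiction 0<0 (<-irrefl refl)
  ι-pos⁻¹ {suc n} _   = s≤s z≤n

  -- Bernoulli's inequality (1 + δ / μ) ^ k ≥ 1 + k δ / μ, multiplied by
  -- μ ^ (k + 1).
  bernoulli : ∀ {μ δ} → 0# ≤ μ → 0# ≤ δ → ∀ k →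
              μ ^ k * (μ + ι k * δ) ≤ μ * (μ + δ) ^ k
  bernoulli {μ} {δ} _   _   zero    = inj₂ (begin-equality
    1# * (μ + 0# * δ)  ≈⟨ *-identityˡ _ ⟩
    μ + 0# * δ         ≈⟨ +-congˡ (zeroˡ δ) ⟩
    μ + 0#             ≈⟨ +-identityʳ μ ⟩
    μ                  ≈⟨ *-identityʳ μ ⟨
    μ * 1#             ∎)
  bernoulli {μ} {δ} 0≤μ 0≤δ (suc k) = begin
    (μ * μ ^ k) * (μ + (1# + ι k) * δ)
      ≈⟨ *-congˡ (+-congˡ (trans (distribʳ δ 1# (ι k)) (+-congʳ (*-identityˡ δ)))) ⟩
    (μ * p) * (μ + (δ + ι k * δ))
      ≈⟨ +-identityʳ _ ⟨
    (μ * p) * (μ + (δ + ι k * δ)) + 0#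
      ≤⟨ +-monoʳ-≤ _ (*-nonNeg (^-nonNeg 0≤μ k) (*-nonNeg (*-nonNeg (ι-nonNeg k) 0≤δ) 0≤δ)) ⟩
    (μ * p) * (μ + (δ + ι k * δ)) + p * ((ι k * δ) * δ)
      ≈⟨ solve 4 (λ μ δ p e → (μ :* p) :* (μ :+ (δ :+ e)) :+ p :* (e :* δ)
                            := (p :* (μ :+ e)) :* (μ :+ δ)) refl μ δ p (ι k * δ) ⟩
    (p * (μ + ι k * δ)) * (μ + δ)
      ≤⟨ *-monoˡ-≤ (+-nonNeg 0≤μ 0≤δ) (bernoulli 0≤μ 0≤δ k) ⟩
    (μ * (μ + δ) ^ k) * (μ + δ)
      ≈⟨ trans (*-assoc μ _ _) (*-congˡ (*-comm _ _)) ⟩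
    μ * ((μ + δ) * (μ + δ) ^ k)
      ∎
    where
    p = μ ^ k
    +-monoʳ-≤ : ∀ {x y} z → x ≤ y → z + x ≤ z + y
    +-monoʳ-≤ z (inj₁ x<y) = inj₁ (+-monoʳ-< z x<y)
    +-monoʳ-≤ z (inj₂ x≈y) = inj₂ (+-congˡ x≈y)

  ⁻¹-inverseˡ : ∀ {x} → 0# < x → x ⁻¹ * x ≈ 1#
  ⁻¹-inverseˡ {x} 0<x = trans (*-comm _ x) (*-inverseʳ λ x≈0 → <-irrefl (sym x≈0) 0<x)

  -- Every x is below a positive natural multiple of a given ε > 0.
  archimedean⁺ : ∀ x {ε} → 0# < ε → ∃[ k ] x < ι (suc k) * ε
  archimedean⁺ x {ε} 0<ε with k , xε⁻¹<k ← archimedean (x * ε ⁻¹) = k , (begin-strict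
    x                 ≈⟨ *-identityʳ x ⟨
    x * 1#            ≈⟨ *-congˡ (⁻¹-inverseˡ 0<ε) ⟨
    x * (ε ⁻¹ * ε)    ≈⟨ *-assoc x _ ε ⟨
    x * ε ⁻¹ * ε      <⟨ *-monoˡ-< 0<ε xε⁻¹<k ⟩
    ι k * ε           <⟨ *-monoˡ-< 0<ε (<-respˡ (+-identityˡ (ι k)) (+-monoˡ-< (ι k) 0<1)) ⟩
    ι (suc k) * ε     ∎)

  <*⁻¹⇔*< : ∀ {x y z} → 0# < z → x < y * z ⁻¹ ⇔ x * z < y
  <*⁻¹⇔*< {x} {y} {z} 0<z = mk⇔
    (λ x<yz⁻¹ → <-respʳ yz⁻¹z≈y (*-monoˡ-< 0<z x<yz⁻¹))
    (λ xz<y → *-cancelʳ-< (inj₁ 0<z) (<-respʳ (sym yz⁻¹z≈y) xz<y))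
    where
    yz⁻¹z≈y : y * z ⁻¹ * z ≈ y
    yz⁻¹z≈y = begin-equality
      y * z ⁻¹ * z    ≈⟨ *-assoc y _ z ⟩
      y * (z ⁻¹ * z)  ≈⟨ *-congˡ (⁻¹-inverseˡ 0<z) ⟩
      y * 1#          ≈⟨ *-identityʳ y ⟩
      y               ∎

  -- A geometric sequence with the larger ratio eventually wins, whatever the
  -- leading coefficients.
  geometric-overtakes : ∀ {ϱ μ c b} → 0# ≤ μ → μ < b → 0# < c →
                        ∃[ k ] ϱ * μ ^ suc k < c * b ^ suc k
  geometric-overtakes {ϱ} {μ} {c} {b} (inj₂ 0≈μ) μ<b 0<c = 0 , (begin-strict
    ϱ * (μ * 1#)   ≈⟨ *-congˡ (trans (*-identityʳ μ) (sym 0≈μ)) ⟩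
    ϱ * 0#         ≈⟨ zeroʳ ϱ ⟩
    0#             <⟨ *-pos 0<c (^-pos (<-respˡ (sym 0≈μ) μ<b) 1) ⟩
    c * (b * 1#)   ∎)
  geometric-overtakes {ϱ} {μ} {c} {b} (inj₁ 0<μ) μ<b 0<c
    with k , ϱμ< ← archimedean⁺ (ϱ * μ) (*-pos 0<c (x<y⇒0<y-x μ<b)) =
    k , *-cancelʳ-< (inj₁ 0<μ) (begin-strict
      (ϱ * p) * μ
        ≈⟨ solve 3 (λ ϱ p μ → (ϱ :* p) :* μ := (ϱ :* μ) :* p) refl ϱ p μ ⟩
      (ϱ * μ) * p
        <⟨ *-monoˡ-< (^-pos 0<μ n) ϱμ< ⟩
      (ι n * (c * δ)) * p
        ≈⟨ +-identityˡ _ ⟨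
      0# + (ι n * (c * δ)) * p
        <⟨ +-monoˡ-< _ (*-pos 0<c (*-pos (^-pos 0<μ n) 0<μ)) ⟩
      c * (p * μ) + (ι n * (c * δ)) * p
        ≈⟨ solve 5 (λ c p μ n δ → c :* (p :* μ) :+ (n :* (c :* δ)) :* p
                                := c :* (p :* (μ :+ n :* δ))) refl c p μ (ι n) δ ⟩
      c * (p * (μ + ι n * δ))
        ≤⟨ *-monoʳ-≤ (inj₁ 0<c) (bernoulli (inj₁ 0<μ) (inj₁ (x<y⇒0<y-x μ<b)) n) ⟩
      c * (μ * (μ + δ) ^ n)
        ≈⟨ *-congˡ (*-congˡ (^-congˡ n (trans (+-comm μ δ) (x-y+y≈x b μ)))) ⟩
      c * (μ * b ^ n)
        ≈⟨ solve 3 (λ c μ q → c :* (μ :* q) := (c :* q) :* μ) refl c μ (b ^ n) ⟩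
      (c * b ^ n) * μ ∎)
    where
    n = suc k
    p = μ ^ n
    δ = b + - μ

-- Sequences over a finite alphabet.

module Patterns where

  open import Data.Nat.Base using (_+_; _*_; _^_; _<_; _≤_)
  private module ℕSolver = Data.Nat.Solver.+-*-Solver

  Stream : ℕ → Set
  Stream q = ℕ → Fin q

  tail : ∀ {q} → Stream q → Stream q
  tail d k = d (suc k)

  shift : ∀ {q} → ℕ → Stream q → Stream q
  shift i d k = d (i + k)

  -- The two sequences have the same first L letters.
  Agree : ∀ {q} → ℕ → Stream q → Stream q → Set
  Agree L d e = ∀ k → k < L → d k ≡ e k

  -- The first i letters of d, followed by f.
  glue : ∀ {q} → ℕ → Stream q → Stream q → Stream q
  glue zero    d f         = f
  glue (suc i) d f zero    = d zero
  glue (suc i) d f (suc k) = glue i (tail d) f k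

  m<n⇒∃[o]m+1+o≡n : ∀ {m n} → m < n → ∃[ o ] m + suc o ≡ n
  m<n⇒∃[o]m+1+o≡n {m} m<n =
    let o , eq = ℕ.m≤n⇒∃[o]m+o≡n m<n in o , ≡.trans (ℕ.+-suc m o) eq

  module _ {q : ℕ} where

    Agree-sym : ∀ {L} {d e : Stream q} → Agree L d e → Agree L e d
    Agree-sym d~e k k<L = ≡.sym (d~e k k<L)

    Agree-trans : ∀ {L} {d e f : Stream q} → Agree L d e → Agree L e f → Agree L d f
    Agree-trans d~e e~f k k<L = ≡.trans (d~e k k<L) (e~f k k<L)

    Agree-≤ : ∀ {L L′} {d e : Stream q} → L ≤ L′ → Agree L′ d e → Agree L d e
    Agree-≤ L≤L′ d~e k k<L = d~e k (ℕ.≤-trans k<L L≤L′)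

    Agree-tail : ∀ {L} {d e : Stream q} → Agree (suc L) d e → Agree L (tail d) (tail e)
    Agree-tail d~e k k<L = d~e (suc k) (s≤s k<L)

    Agree-shift : ∀ i {L} {d e : Stream q} →
                  Agree (i + L) d e → Agree L (shift i d) (shift i e)
    Agree-shift i d~e k k<L = d~e (i + k) (ℕ.+-monoʳ-< i k<L)

    Agree? : ∀ L (d e : Stream q) → Dec (Agree L d e)
    Agree? L d e = map′ {A = ∀ {k} → k < L → d k ≡ e k} (λ d~e k → d~e {k}) (λ d~e {k} → d~e k)
                       (ℕ.allUpTo? (λ k → d k Fin.≟ e k) L)

    -- If f continues d after i letters for another M letters, then gluing f
    -- to d after i letters does not change the first i + M letters.
    glue-agree : ∀ {M} i {d f : Stream q} → Agree M f (shift i d) →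
                 Agree (i + M) (glue i d f) d
    glue-agree zero    f~d                 = f~d
    glue-agree (suc i) f~d zero    _       = ≡.refl
    glue-agree (suc i) f~d (suc k) (s≤s h) = glue-agree i f~d k h

    -- Exhaustive search over the first L letters. The letter x fills the
    -- remaining positions.
    anyStream? : ∀ {p} L {P : Stream q → Set p} → Fin q →
                 (∀ {d e} → Agree L d e → P d → P e) →
                 (∀ d → Dec (P d)) → Dec (∃ P)
    anyStream? zero    x resp P? =
      map′ (_ ,_) (λ (_ , Pd) → resp (λ _ ()) Pd) (P? (λ _ → x))
    anyStream? (suc L) {P} x resp P? =
      map′ (λ (a , d , Pad) → a ∷ₛ d , Pad)
           (λ (d , Pd) → d zero , tail d , resp (λ k _ → d≗ d k) Pd)
           (Fin.any? λ a → anyStream? L x (resp ∘ ∷ₛ-agree a) (λ d → P? (a ∷ₛ d)))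
      where
      _∷ₛ_ : Fin q → Stream q → Stream q
      (a ∷ₛ d) zero    = a
      (a ∷ₛ d) (suc k) = d k

      ∷ₛ-agree : ∀ a {d e} → Agree L d e → Agree (suc L) (a ∷ₛ d) (a ∷ₛ e)
      ∷ₛ-agree a d~e zero    _         = ≡.refl
      ∷ₛ-agree a d~e (suc k) (s≤s k<L) = d~e k k<L

      d≗ : ∀ d k → d k ≡ (d zero ∷ₛ tail d) k
      d≗ d zero    = ≡.refl
      d≗ d (suc k) = ≡.refl

    -- There are only q ^ M words of length M, so among the windows of width M
    -- at the positions 0, …, q ^ M two coincide.
    repeatedWindow : ∀ M (f : Stream q) → ∃[ i ] ∃[ ℓ ]
      i + suc ℓ ≤ q ^ M × Agree M (shift i f) (shift (suc ℓ) (shift i f))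
    repeatedWindow M f
      with i , j , i<j , eq ← Fin.pigeonhole (ℕ.n<1+n (q ^ M))
                                (λ i → funToFin (λ (k : Fin M) → f (toℕ i + toℕ k)))
      with ℓ , i+ℓ≡j ← m<n⇒∃[o]m+1+o≡n i<j =
      toℕ i , ℓ , ℕ.≤-trans (ℕ.≤-reflexive i+ℓ≡j) (Fin.toℕ≤pred[n] j) , agree
      where
      same : ∀ (k : Fin M) → f (toℕ i + toℕ k) ≡ f (toℕ j + toℕ k)
      same k = ≡.trans (≡.sym (Fin.finToFun-funToFin _ k))
                 (≡.trans (≡.cong (λ w → finToFun w k) eq) (Fin.finToFun-funToFin _ k))

      agree : Agree M (shift (toℕ i) f) (shift (suc ℓ) (shift (toℕ i) f))
      agree k k<M = begin
        f (toℕ i + k)                ≡⟨ ≡.cong (λ k → f (toℕ i + k)) (Fin.toℕ-fromℕ< k<M) ⟨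
        f (toℕ i + toℕ (fromℕ< k<M)) ≡⟨ same (fromℕ< k<M) ⟩
        f (toℕ j + toℕ (fromℕ< k<M)) ≡⟨ ≡.cong (λ k → f (toℕ j + k)) (Fin.toℕ-fromℕ< k<M) ⟩
        f (toℕ j + k)                ≡⟨ ≡.cong (λ j → f (j + k)) i+ℓ≡j ⟨
        f ((toℕ i + suc ℓ) + k)      ≡⟨ ≡.cong f (ℕ.+-assoc (toℕ i) (suc ℓ) k) ⟩
        f (toℕ i + (suc ℓ + k))      ∎
        where open ≡.≡-Reasoning

-- Weights of words.

  m*n>0⇒m>0 : ∀ m {n} → 0 < m * n → 0 < m
  m*n>0⇒m>0 m mn>0 = ℕ.>-nonZero⁻¹ m {{ℕ.m*n≢0⇒m≢0 m {{ℕ.>-nonZero mn>0}}}}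

  m*n>0⇒n>0 : ∀ m {n} → 0 < m * n → 0 < n
  m*n>0⇒n>0 m {n} mn>0 = ℕ.>-nonZero⁻¹ n {{ℕ.m*n≢0⇒n≢0 m {{ℕ.>-nonZero mn>0}}}}

  -- The weight g depends on the first M + 1 letters only.
  Local : ∀ {q} → ℕ → (Stream q → ℕ) → Set
  Local M g = ∀ {d e} → Agree (suc M) d e → g d ≡ g e

  -- The weights of a site as a function of the sequence that starts at the
  -- left end of its neighbourhood: gx for writing x there, gy for y, gz for
  -- z. Two consecutive neighbourhoods share a window of M letters.
  module Weights {q M : ℕ} (gx gy gz : Stream q → ℕ)
    (gx-local : Local M gx) (gy-local : Local M gy) (gz-local : Local M gz) where

    -- The weight of n consecutive y-sites.
    body : ℕ → Stream q → ℕ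
    body zero    d = 1
    body (suc n) d = gy d * body n (tail d)

    -- The weight of n consecutive y-sites and a final z-site.
    end : ℕ → Stream q → ℕ
    end zero    d = gz d
    end (suc n) d = gy d * end n (tail d)

    -- The weight of the pattern x y ^ n z.
    total : ℕ → Stream q → ℕ
    total n d = gx d * end n (tail d)

    body-local : ∀ n {d e} → Agree (n + M) d e → body n d ≡ body n e
    body-local zero    _   = ≡.refl
    body-local (suc n) d~e =
      ≡.cong₂ _*_ (gy-local (Agree-≤ (s≤s (ℕ.m≤n+m M n)) d~e)) (body-local n (Agree-tail d~e))

    end-local : ∀ n {d e} → Agree (n + suc M) d e → end n d ≡ end n e
    end-local zero    d~e = gz-local d~e
    end-local (suc n) d~e =
      ≡.cong₂ _*_ (gy-local (Agree-≤ (ℕ.m≤n+m (suc M) (suc n)) d~e)) (end-local n (Agree-tail d~e))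

    total-local : ∀ n {d e} → Agree (suc n + suc M) d e → total n d ≡ total n e
    total-local n d~e =
      ≡.cong₂ _*_ (gx-local (Agree-≤ (ℕ.m≤n+m (suc M) (suc n)) d~e)) (end-local n (Agree-tail d~e))

    end-split : ∀ i t d → end (i + t) d ≡ body i d * end t (shift i d)
    end-split zero    t d = ≡.sym (ℕ.+-identityʳ _)
    end-split (suc i) t d = ≡.trans (≡.cong (gy d *_) (end-split i t (tail d)))
                                    (≡.sym (ℕ.*-assoc (gy d) _ _))

    -- If f shares the window of d at position i, then the walk d can change
    -- over to f there, without affecting the weights of either part.
    end-glue : ∀ i t {d f} → Agree M f (shift i d) →
               end (i + t) (glue i d f) ≡ body i d * end t f
    end-glue zero    t         f~d = ≡.sym (ℕ.+-identityʳ _)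
    end-glue (suc i) t {d} {f} f~d = begin
      gy (glue (suc i) d f) * end (i + t) (glue i (tail d) f)
        ≡⟨ ≡.cong₂ _*_ (gy-local (Agree-≤ (s≤s (ℕ.m≤n+m M i)) (glue-agree (suc i) f~d)))
                       (end-glue i t f~d) ⟩
      gy d * (body i (tail d) * end t f)
        ≡⟨ ℕ.*-assoc (gy d) _ _ ⟨
      gy d * body i (tail d) * end t f ∎
      where open ≡.≡-Reasoning

    total-glue : ∀ i t {d f} → Agree M f (shift (suc i) d) →
                 total (i + t) (glue (suc i) d f) ≡ gx d * (body i (tail d) * end t f)
    total-glue i t f~d = ≡.cong₂ _*_
      (gx-local (Agree-≤ (s≤s (ℕ.m≤n+m M i)) (glue-agree (suc i) f~d)))
      (end-glue i t f~d)

    -- k copies of the first ℓ letters of u, followed by f.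
    pump : ℕ → ℕ → Stream q → Stream q → Stream q
    pump ℓ zero    u f = f
    pump ℓ (suc k) u f = glue ℓ u (pump ℓ k u f)

    module _ {ℓ} {u f : Stream q} (cycle : Agree M u (shift ℓ u)) (f~u : Agree M f u) where

      pump-agree : ∀ k → Agree M (pump ℓ k u f) u
      pump-agree zero    = f~u
      pump-agree (suc k) =
        Agree-≤ (ℕ.m≤n+m M ℓ) (glue-agree ℓ (Agree-trans (pump-agree k) cycle))

      end-pump : ∀ k t → end (k * ℓ + t) (pump ℓ k u f) ≡ body ℓ u ^ k * end t f
      end-pump zero    t = ≡.sym (ℕ.+-identityʳ _)
      end-pump (suc k) t = begin
        end (ℓ + k * ℓ + t) (pump ℓ (suc k) u f)
          ≡⟨ ≡.cong (λ n → end n (pump ℓ (suc k) u f)) (ℕ.+-assoc ℓ (k * ℓ) t) ⟩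
        end (ℓ + (k * ℓ + t)) (pump ℓ (suc k) u f)
          ≡⟨ end-glue ℓ (k * ℓ + t) (Agree-trans (pump-agree k) cycle) ⟩
        body ℓ u * end (k * ℓ + t) (pump ℓ k u f)
          ≡⟨ ≡.cong (body ℓ u *_) (end-pump k t) ⟩
        body ℓ u * (body ℓ u ^ k * end t f)
          ≡⟨ ℕ.*-assoc (body ℓ u) _ _ ⟨
        body ℓ u ^ suc k * end t f ∎
        where open ≡.≡-Reasoning

    -- The number of windows.
    N : ℕ
    N = q ^ M

    -- A walk of length t > N contains a cycle of length ℓ + 1 which ends
    -- within its first N steps and so before its last step.
    findCycle : ∀ {t} (f : Stream q) → N < t → ∃[ i ] ∃[ ℓ ] ∃[ t′ ]
      t ≡ i + (suc ℓ + suc t′) × i + suc ℓ ≤ N × Agree M (shift i f) (shift (suc ℓ) (shift i f))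
    findCycle {t} f N<t
      with i , ℓ , bound , cycle ← repeatedWindow M f
      with t′ , eq ← m<n⇒∃[o]m+1+o≡n (ℕ.≤-<-trans bound N<t) =
      i , ℓ , t′ , ≡.trans (≡.sym eq) (ℕ.+-assoc i (suc ℓ) (suc t′)) , bound , cycle

    -- A window (the first M letters of u) from which the pattern can be
    -- completed with positive probability.
    Completable : Stream q → Set
    Completable u = ∃[ t ] ∃[ f ] (Agree M u f × 0 < end t f)

    -- Cutting out a cycle keeps the weight positive.
    completeShortly : ∀ t f → Acc _<_ t → 0 < end t f →
                      ∃[ t′ ] (t′ < suc N × ∃[ f′ ] (Agree M f f′ × 0 < end t′ f′))
    completeShortly t f (acc rec) 0<end with t ℕ.≤? N
    ... | yes t≤N = t , s≤s t≤N , f , (λ _ _ → ≡.refl) , 0<end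
    ... | no  t≰N with i , ℓ , t′ , ≡.refl , _ , cycle ← findCycle f (ℕ.≰⇒> t≰N) =
      let u = shift i f
          v = shift (suc ℓ) u
          0<abc = ≡.subst (0 <_) (≡.trans (end-split i (suc ℓ + suc t′) f)
                    (≡.cong (body i f *_) (end-split (suc ℓ) (suc t′) u))) 0<end
          0<c  = m*n>0⇒n>0 (body (suc ℓ) u) (m*n>0⇒n>0 (body i f) 0<abc)
          0<ac = ℕ.*-mono-< (m*n>0⇒m>0 (body i f) 0<abc) 0<c
          t″ , bound , f″ , cut~f″ , 0<end″ = completeShortly (i + suc t′) (glue i f v)
            (rec (ℕ.+-monoʳ-< i (ℕ.m<n+m (suc t′) (s≤s z≤n))))
            (≡.subst (0 <_) (≡.sym (end-glue i (suc t′) (Agree-sym cycle))) 0<ac)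
          f~cut = Agree-sym (Agree-≤ (ℕ.m≤n+m M i) (glue-agree i (Agree-sym cycle)))
      in t″ , bound , f″ , Agree-trans f~cut cut~f″ , 0<end″

    Completable? : Fin q → ∀ u → Dec (Completable u)
    Completable? x u = map′
      (λ (t , _ , f , u~f , 0<end) → t , f , u~f , 0<end)
      (λ (t , f , u~f , 0<end) →
         let t′ , bound , f′ , f~f′ , 0<end′ = completeShortly t f (<-wellFounded t) 0<end
         in t′ , bound , f′ , Agree-trans u~f f~f′ , 0<end′)
      (ℕ.anyUpTo? (λ t → anyStream? (t + suc M) x
          (λ {d} {e} d~e (u~d , 0<end) →
             Agree-trans u~d (Agree-≤ (ℕ.≤-trans (ℕ.n≤1+n M) (ℕ.m≤n+m (suc M) t)) d~e) ,
             ≡.subst (0 <_) (end-local t d~e) 0<end)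
          (λ f → Agree? M u f ×-dec (0 ℕ.<? end t f)))
        (suc N))

-- Deciding whether the weights exceed a geometric threshold.

    module Threshold {a ℓ₁ ℓ₂} (K : ExactReals a ℓ₁ ℓ₂)
      (α lam : ExactReals.Carrier K)
      (0≤α : ExactReals._≤_ K (ExactReals.0# K) α)
      (0≤lam : ExactReals._≤_ K (ExactReals.0# K) lam) where

      open ExactReals K using (0#; trans; reflexive; *-congˡ; *-assoc; semiring)
        renaming (_≈_ to _≈ᴷ_; _<_ to _<ᴷ_; _≤_ to _≤ᴷ_; _*_ to _*ᴷ_; _^_ to _^ᴷ_)
      open OrderedField K
      open Algebra.Properties.Semiring.Exp semiring using (^-homo-*; ^-assocʳ)

      -- The pattern x y ^ n z has weight above the threshold.
      Exceeds : ℕ → Stream q → Set ℓ₂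
      Exceeds n d = α *ᴷ lam ^ᴷ n <ᴷ ι (total n d)

      <ι-respʳ : ∀ {x m n} → m ≡ n → x <ᴷ ι m → x <ᴷ ι n
      <ι-respʳ ≡.refl x<m = x<m

      ι-cycle : ∀ g a b c → ι (g * (a * (b * c))) ≈ᴷ ι (g * (a * c)) *ᴷ ι b
      ι-cycle g a b c = trans (reflexive (≡.cong ι (ℕSolver.solve 4
          (λ g a b c → g ℕSolver.:* (a ℕSolver.:* (b ℕSolver.:* c))
                       ℕSolver.:= g ℕSolver.:* (a ℕSolver.:* c) ℕSolver.:* b) ≡.refl g a b c)))
        (ι-* (g * (a * c)) b)

      -- Here g, a, b, c are the weights of the first site, of the way to the
      -- cycle, of the cycle, and of the rest. Cutting out a cycle of weight at
      -- most lam ^ ℓ reduces the weight by no larger a factor than the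
      -- threshold.
      remove-cycle : ∀ i ℓ t g a b c → ι b ≤ᴷ lam ^ᴷ ℓ →
                     α *ᴷ lam ^ᴷ (i + (ℓ + t)) <ᴷ ι (g * (a * (b * c))) →
                     α *ᴷ lam ^ᴷ (i + t) <ᴷ ι (g * (a * c))
      remove-cycle i ℓ t g a b c b≤ exceeds = *-cancelʳ-< (^-nonNeg 0≤lam ℓ) (begin-strict
        (α *ᴷ lam ^ᴷ (i + t)) *ᴷ lam ^ᴷ ℓ  ≈⟨ *-assoc α _ _ ⟩
        α *ᴷ (lam ^ᴷ (i + t) *ᴷ lam ^ᴷ ℓ)  ≈⟨ *-congˡ (^-homo-* lam (i + t) ℓ) ⟨
        α *ᴷ lam ^ᴷ (i + t + ℓ)            ≡⟨ ≡.cong (λ n → α *ᴷ lam ^ᴷ n) exponent ⟩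
        α *ᴷ lam ^ᴷ (i + (ℓ + t))          <⟨ exceeds ⟩
        ι (g * (a * (b * c)))              ≈⟨ ι-cycle g a b c ⟩
        ι (g * (a * c)) *ᴷ ι b             ≤⟨ *-monoʳ-≤ (ι-nonNeg (g * (a * c))) b≤ ⟩
        ι (g * (a * c)) *ᴷ lam ^ᴷ ℓ        ∎)
        where
        exponent : i + t + ℓ ≡ i + (ℓ + t)
        exponent = ≡.trans (ℕ.+-assoc i t ℓ) (≡.cong (λ n → i + n) (ℕ.+-comm t ℓ))

      -- Repeating a cycle of weight above lam ^ ℓ. If ℓ is positive, then
      -- so is the length of the resulting run, as k + 1 is.
      repeat-cycle : ∀ i ℓ t g a b c → lam ^ᴷ ℓ <ᴷ ι b → 0 < g * a → 0 < c →
                     ∃[ k ] α *ᴷ lam ^ᴷ (i + (suc k * ℓ + t)) <ᴷ ι (g * (a * (b ^ suc k * c)))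
      repeat-cycle i ℓ t g a b c <b 0<ga 0<c
        with k , overtakes ← geometric-overtakes {α *ᴷ lam ^ᴷ (i + t)} {c = ι (g * (a * c))}
               (^-nonNeg 0≤lam ℓ) <b
               (ι-pos (≡.subst (0 <_) (ℕ.*-assoc g a c) (ℕ.*-mono-< 0<ga 0<c))) =
        k , (begin-strict
          α *ᴷ lam ^ᴷ (i + (suc k * ℓ + t))
            ≡⟨ ≡.cong (λ n → α *ᴷ lam ^ᴷ n) exponent ⟩
          α *ᴷ lam ^ᴷ (i + t + ℓ * suc k)
            ≈⟨ *-congˡ (^-homo-* lam (i + t) (ℓ * suc k)) ⟩
          α *ᴷ (lam ^ᴷ (i + t) *ᴷ lam ^ᴷ (ℓ * suc k))
            ≈⟨ *-assoc α _ _ ⟨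
          (α *ᴷ lam ^ᴷ (i + t)) *ᴷ lam ^ᴷ (ℓ * suc k)
            ≈⟨ *-congˡ (^-assocʳ lam ℓ (suc k)) ⟨
          (α *ᴷ lam ^ᴷ (i + t)) *ᴷ (lam ^ᴷ ℓ) ^ᴷ suc k
            <⟨ overtakes ⟩
          ι (g * (a * c)) *ᴷ ι b ^ᴷ suc k
            ≈⟨ *-congˡ (ι-^ b (suc k)) ⟨
          ι (g * (a * c)) *ᴷ ι (b ^ suc k)
            ≈⟨ ι-cycle g a (b ^ suc k) c ⟨
          ι (g * (a * (b ^ suc k * c))) ∎)
        where
        exponent : ∀ {k} → i + (suc k * ℓ + t) ≡ i + t + ℓ * suc k
        exponent {k} = ≡.trans (≡.cong (λ n → i + n) (≡.trans (ℕ.+-comm (suc k * ℓ) t)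
                                                 (≡.cong (λ n → t + n) (ℕ.*-comm (suc k) ℓ))))
                               (≡.sym (ℕ.+-assoc i t (ℓ * suc k)))

      -- After the first site and i further ones, the walk d runs through a
      -- cycle of length ℓ + 1 and of weight above lam ^ (ℓ + 1). The way to the
      -- cycle has positive weight, and so has some way from it to a site
      -- carrying z. The latter need not be the continuation of d.
      Lasso : ℕ → ℕ → Stream q → Set ℓ₂
      Lasso i ℓ d = 0 < gx d * body i (tail d) × Agree M u (shift (suc ℓ) u) ×
                    lam ^ᴷ suc ℓ <ᴷ ι (body (suc ℓ) u) × Completable u
        where u = shift i (tail d)

      -- A pattern of bounded length with weight above the threshold.
      ShortExceeding : Set ℓ₂
      ShortExceeding = ∃[ n ] (n < suc N × ∃[ d ] (1 ≤ n × Exceeds n d))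

      -- A lasso whose prefix and cycle have bounded length.
      ShortLasso : Set ℓ₂
      ShortLasso = ∃[ i ] (i < suc N × ∃[ ℓ ] (ℓ < suc N × ∃[ d ] Lasso i ℓ d))

      shortExceeding? : Fin q → Dec ShortExceeding
      shortExceeding? x = ℕ.anyUpTo? (λ n → anyStream? (suc n + suc M) x
        (λ d~e (1≤n , exceeds) →
           1≤n , <ι-respʳ (total-local n d~e) exceeds)
        (λ d → (1 ℕ.≤? n) ×-dec (α *ᴷ lam ^ᴷ n <? ι (total n d)))) (suc N)

      lasso-local : ∀ i ℓ {d e} → Agree (suc (i + (suc ℓ + suc M))) d e → Lasso i ℓ d → Lasso i ℓ e
      lasso-local i ℓ {d} {e} d~e (0<prefix , cycle , beats , t , f , u~f , 0<end) =
        ≡.subst (0 <_)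
          (≡.cong₂ _*_
            (gx-local (Agree-≤ (s≤s (ℕ.≤-trans (ℕ.m≤n+m M i) (ℕ.+-monoʳ-≤ i M≤))) d~e))
            (body-local i (Agree-≤ (ℕ.+-monoʳ-≤ i M≤) (Agree-tail d~e))))
          0<prefix ,
        Agree-trans v~u (Agree-trans cycle (Agree-shift (suc ℓ) (Agree-≤ ℓ+M≤ u~v))) ,
        <ι-respʳ (body-local (suc ℓ) (Agree-≤ ℓ+M≤ u~v)) beats ,
        t , f , Agree-trans v~u u~f , 0<end
        where
        ℓ+M≤ : suc ℓ + M ≤ suc ℓ + suc M
        ℓ+M≤ = ℕ.+-monoʳ-≤ (suc ℓ) (ℕ.n≤1+n M)
        M≤ : M ≤ suc ℓ + suc M
        M≤ = ℕ.≤-trans (ℕ.m≤n+m M (suc ℓ)) ℓ+M≤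
        u~v : Agree (suc ℓ + suc M) (shift i (tail d)) (shift i (tail e))
        u~v = Agree-shift i (Agree-tail d~e)
        v~u : Agree M (shift i (tail e)) (shift i (tail d))
        v~u = Agree-sym (Agree-≤ M≤ u~v)

      shortLasso? : Fin q → Dec ShortLasso
      shortLasso? x = ℕ.anyUpTo? (λ i → ℕ.anyUpTo? (λ ℓ →
        anyStream? (suc (i + (suc ℓ + suc M))) x (lasso-local i ℓ) (λ d →
          let u = shift i (tail d) in
          (0 ℕ.<? gx d * body i (tail d)) ×-dec Agree? M u (shift (suc ℓ) u) ×-dec
          (lam ^ᴷ suc ℓ <? ι (body (suc ℓ) u)) ×-dec Completable? x u)) (suc N)) (suc N)

      lasso⇒exceeds : ∀ i ℓ {d} → Lasso i ℓ d → ∃[ d′ ] ∃[ n ] (1 ≤ n × Exceeds n d′)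
      lasso⇒exceeds i ℓ {d} (0<prefix , cycle , beats , t , f , u~f , 0<end) =
        let u = shift i (tail d)
            k , exceeds = repeat-cycle i (suc ℓ) t (gx d) (body i (tail d)) (body (suc ℓ) u) (end t f)
                            beats 0<prefix 0<end
            n = suc k * suc ℓ + t
            f~u = Agree-sym u~f
            weight : total (i + n) (glue (suc i) d (pump (suc ℓ) (suc k) u f)) ≡
                     gx d * (body i (tail d) * (body (suc ℓ) u ^ suc k * end t f))
            weight = ≡.trans (total-glue i n (pump-agree cycle f~u (suc k)))
              (≡.cong (λ w → gx d * (body i (tail d) * w)) (end-pump cycle f~u (suc k) t))
        in _ , i + n , ℕ.≤-trans (s≤s z≤n) (ℕ.m≤n+m n i) ,
           <ι-respʳ (≡.sym weight) exceeds

      -- By induction on n: an early cycle of a long walk either beats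
      -- the threshold or can be cut out.
      exceeds⇒short⊎lasso : ∀ n d → Acc _<_ n → 1 ≤ n → Exceeds n d → ShortExceeding ⊎ ShortLasso
      exceeds⇒short⊎lasso n d (acc rec) 1≤n exceeds with n ℕ.≤? N
      ... | yes n≤N = inj₁ (n , s≤s n≤N , d , 1≤n , exceeds)
      ... | no  n≰N with i , ℓ , t′ , ≡.refl , bound , cycle ← findCycle (tail d) (ℕ.≰⇒> n≰N) = byCycle
        where
        t = suc t′
        u = shift i (tail d)
        v = shift (suc ℓ) u
        A = body i (tail d)
        B = body (suc ℓ) u
        C = end t v

        weight : total (i + (suc ℓ + t)) d ≡ gx d * (A * (B * C))
        weight = ≡.cong (gx d *_) (≡.trans (end-split i (suc ℓ + t) (tail d))
                                           (≡.cong (A *_) (end-split (suc ℓ) t u)))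

        exceeds′ : α *ᴷ lam ^ᴷ (i + (suc ℓ + t)) <ᴷ ι (gx d * (A * (B * C)))
        exceeds′ = <ι-respʳ weight exceeds

        0<gABC : 0 < gx d * (A * (B * C))
        0<gABC = ι-pos⁻¹ (begin-strict
          0#                              ≤⟨ *-nonNeg 0≤α (^-nonNeg 0≤lam (i + (suc ℓ + t))) ⟩
          α *ᴷ lam ^ᴷ (i + (suc ℓ + t))  <⟨ exceeds′ ⟩
          ι (gx d * (A * (B * C)))        ∎)

        0<ABC : 0 < A * (B * C)
        0<ABC = m*n>0⇒n>0 (gx d) 0<gABC

        byCycle : ShortExceeding ⊎ ShortLasso
        byCycle with lam ^ᴷ suc ℓ <? ι B
        ... | yes beats = inj₂ (i , s≤s (ℕ.≤-trans (ℕ.m≤m+n i (suc ℓ)) bound) ,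
                                ℓ , s≤s (ℕ.≤-trans (ℕ.≤-trans (ℕ.n≤1+n ℓ) (ℕ.m≤n+m (suc ℓ) i)) bound) ,
                                d , ℕ.*-mono-< (m*n>0⇒m>0 (gx d) 0<gABC) (m*n>0⇒m>0 A 0<ABC) ,
                                cycle , beats , t , v , cycle ,
                                m*n>0⇒n>0 B (m*n>0⇒n>0 A 0<ABC))
        ... | no  fails = exceeds⇒short⊎lasso (i + t) (glue (suc i) d v)
          (rec (ℕ.+-monoʳ-< i (ℕ.m<n+m t (s≤s z≤n))))
          (ℕ.≤-trans (s≤s z≤n) (ℕ.m≤n+m t i))
          (<ι-respʳ (≡.sym (total-glue i t (Agree-sym cycle)))
            (remove-cycle i (suc ℓ) t (gx d) A B C (≮⇒≥ fails) exceeds′))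

      -- The letter x is any letter, witnessing that the alphabet is inhabited.
      exceeding? : Fin q → Dec (∃[ d ] ∃[ n ] (1 ≤ n × Exceeds n d))
      exceeding? x = map′
        (λ { (inj₁ (n , _ , d , exceeds))   → d , n , exceeds
           ; (inj₂ (i , _ , ℓ , _ , _ , lasso)) → lasso⇒exceeds i ℓ lasso })
        (λ (d , n , 1≤n , exceeds) → exceeds⇒short⊎lasso n d (<-wellFounded n) 1≤n exceeds)
        (shortExceeding? x ⊎-dec shortLasso? x)

-- Counting words.

  module _ {A B : Set} {p q} {P : Pred A p} {Q : Pred B q} (P? : Decidable P) (Q? : Decidable Q) where

    length-filter-map : ∀ (h : A → B) (xs : List A) → (∀ x → Q (h x) ⇔ P x) →
                        length (filter Q? (List.map h xs)) ≡ length (filter P? xs)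
    length-filter-map h []       Q⇔P = ≡.refl
    length-filter-map h (x ∷ xs) Q⇔P with Q? (h x) | P? x
    ... | yes _  | yes _  = ≡.cong suc (length-filter-map h xs Q⇔P)
    ... | no  _  | no  _  = length-filter-map h xs Q⇔P
    ... | yes Qx | no ¬Px = contradiction (Equivalence.to (Q⇔P x) Qx) ¬Px
    ... | no ¬Qx | yes Px = contradiction (Equivalence.from (Q⇔P x) Px) ¬Qx

  module _ {A B C : Set} {p q r} {P : Pred A p} {Q : Pred B q} {R : Pred C r}
    (P? : Decidable P) (Q? : Decidable Q) (R? : Decidable R) where

    length-filter-cartesianProductWith : ∀ (g : A → B → C) xs ys →
      (∀ x y → R (g x y) ⇔ (P x × Q y)) →
      length (filter R? (cartesianProductWith g xs ys)) ≡
      length (filter P? xs) * length (filter Q? ys)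
    length-filter-cartesianProductWith g []       ys R⇔P×Q = ≡.refl
    length-filter-cartesianProductWith g (x ∷ xs) ys R⇔P×Q = ≡.trans
      (≡.trans (≡.cong length (List.filter-++ R? (List.map (g x) ys) _))
               (List.length-++ (filter R? (List.map (g x) ys))))
      (≡.trans (≡.cong₂ _+_ head (length-filter-cartesianProductWith g xs ys R⇔P×Q)) sum)
      where
      c = length (filter Q? ys)
      rest = length (filter P? xs)

      -- 1 or 0, according to whether x satisfies P.
      indicator : ℕ
      indicator = length (filter P? (x ∷ []))

      head : length (filter R? (List.map (g x) ys)) ≡ indicator * c
      head with P? x
      ... | yes Px = ≡.trans
        (length-filter-map Q? R? (g x) ys λ y →
          mk⇔ (proj₂ ∘ Equivalence.to (R⇔P×Q x y)) (λ Qy → Equivalence.from (R⇔P×Q x y) (Px , Qy)))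
        (≡.sym (ℕ.+-identityʳ c))
      ... | no ¬Px = ≡.cong length (List.filter-none R? (All.map⁺ (All.universal
        (λ y → ¬Px ∘ proj₁ ∘ Equivalence.to (R⇔P×Q x y)) ys)))

      sum : indicator * c + rest * c ≡ length (filter P? (x ∷ xs)) * c
      sum with P? x
      ... | yes _ = ≡.cong (_+ rest * c) (ℕ.+-identityʳ c)
      ... | no  _ = ≡.refl

  module _ {r : ℕ} .{{_ : NonZero r}} where

    nth-lookup : ∀ {n} (w : Vec (Fin r) n) k → nth w (toℕ k) ≡ lookup w k
    nth-lookup (s ∷ w) Fin.zero    = ≡.refl
    nth-lookup (s ∷ w) (Fin.suc k) = nth-lookup w k

    place-lookup : ∀ {start n} → start ≡ 0ℤ → (w : Vec (Fin r) n) (k : Fin n) →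
                   place start w (+ toℕ k) ≡ lookup w k
    place-lookup ≡.refl w k rewrite ℕ.+-identityʳ (toℕ k) = nth-lookup w k

    module _ {a ℓ₁ ℓ₂} (K : ExactReals a ℓ₁ ℓ₂) where
      open ExactReals K using (_⁻¹) renaming (_*_ to _*ᴷ_)
      open OrderedField K using (ι)

      -- An event that is local to the positions 0, …, n - 1 may be counted by
      -- any decidable description of it in terms of words of length n.
      uniform-count : ∀ E n → LocalEvent.width E ≡ n → LocalEvent.start E ≡ 0ℤ →
        ∀ {p} {P : Pred (Vec (Fin r) n) p} (P? : Decidable P) →
        (∀ s w → (∀ k → s (+ toℕ k) ≡ lookup w k) → LocalEvent.Holds E s ⇔ P w) →
        uniform K E ≡ ι (length (filter P? (words r n))) *ᴷ ι (r ^ n) ⁻¹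
      uniform-count E n ≡.refl start≡0 P? Holds⇔P =
        ≡.cong (λ ws → ι (length ws) *ᴷ ι (r ^ n) ⁻¹)
          (List.filter-≐ (λ w → holds? (placed w)) P?
            ((λ {w} → Equivalence.to   (Holds⇔P (placed w) w (place-lookup start≡0 w))) ,
             (λ {w} → Equivalence.from (Holds⇔P (placed w) w (place-lookup start≡0 w))))
            (words r n))
        where
        open LocalEvent E
        placed : Vec (Fin r) n → ℤ → Fin r
        placed = place start

-- Correlation-free automata as weights.

  ∣i+m∣≡i+m : ∀ i m → ∣ i ∣ ≤ m → + ∣ i ℤ.+ + m ∣ ≡ i ℤ.+ + m
  ∣i+m∣≡i+m (+ k)    m _   = ≡.refl
  ∣i+m∣≡i+m -[1+ k ] m k<m = ≡.trans (≡.cong (λ i → + ∣ i ∣) eq) (≡.sym eq)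
    where
    eq : m ℤ.⊖ suc k ≡ + (m ℕ.∸ suc k)
    eq = ℤ.⊖-≥ k<m

  maxAbs-zero : ∀ {n} (W : Vec ℤ n) → (∀ {v} → v ∈ W → v ≡ 0ℤ) → maxAbs W ≡ 0
  maxAbs-zero []      _  = ≡.refl
  maxAbs-zero (v ∷ W) W0 =
    ≡.cong₂ (λ i m → ∣ i ∣ ℕ.⊔ m) (W0 (here ≡.refl)) (maxAbs-zero W (W0 ∘ there))

  module CorrelationFree (F : StochasticCA) (correlationFree : StochasticCA.CorrelationFree F) where
    open StochasticCA F

    m M : ℕ
    m = maxAbs V
    M = m + m

    -- The law of a pattern at 0 depends on the configuration only at the
    -- positions - m, - m + 1, …, which are numbered from 0 on.
    toStream : (ℤ → Q) → Stream q
    toStream c k = c (+ k ℤ.- + m)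

    -- A configuration with the given letters at these positions. The absolute
    -- value repeats some of the letters at the others, which do not matter.
    fromStream : Stream q → (ℤ → Q)
    fromStream d i = d ∣ i ℤ.+ + m ∣

    toStream-fromStream : ∀ d k → toStream (fromStream d) k ≡ d k
    toStream-fromStream d k = ≡.cong (λ i → d ∣ i ∣) (begin
      + k ℤ.- + m ℤ.+ + m          ≡⟨ ℤ.+-assoc (+ k) (ℤ.- + m) (+ m) ⟩
      + k ℤ.+ (ℤ.- + m ℤ.+ + m)    ≡⟨ ≡.cong (λ i → + k ℤ.+ i) (ℤ.+-inverseˡ (+ m)) ⟩
      + k ℤ.+ 0ℤ                   ≡⟨ ℤ.+-identityʳ (+ k) ⟩
      + k                          ∎)
      where open ≡.≡-Reasoning

    -- What the site at position m of d sees. All offsets in V lie between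
    -- - m and m, so this involves only the first M + 1 letters.
    neighbourhood : Stream q → Vec Q ρ
    neighbourhood d = Vec.map (λ v → d ∣ v ℤ.+ + m ∣) V

    neighbourhood-local : ∀ {d e} → Agree (suc M) d e → neighbourhood d ≡ neighbourhood e
    neighbourhood-local d~e = map-cong-∈ V λ {v} v∈V →
      d~e _ (s≤s (ℕ.≤-trans (ℤ.∣i+j∣≤∣i∣+∣j∣ v (+ m)) (ℕ.+-monoˡ-≤ m (∈⇒∣∣≤maxAbs v∈V))))

    neighbourhood-toStream : ∀ c k → Vec.map (λ v → c (+ k ℤ.+ v)) V ≡
                                     neighbourhood (shift k (toStream c))
    neighbourhood-toStream c k = map-cong-∈ V λ {v} v∈V → ≡.cong c (≡.sym (begin
      + k ℤ.+ + ∣ v ℤ.+ + m ∣ ℤ.- + m  ≡⟨ ≡.cong (λ i → + k ℤ.+ i ℤ.- + m)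
                                               (∣i+m∣≡i+m v m (∈⇒∣∣≤maxAbs v∈V)) ⟩
      + k ℤ.+ (v ℤ.+ + m) ℤ.- + m      ≡⟨ ℤ.+-assoc (+ k) (v ℤ.+ + m) (ℤ.- + m) ⟩
      + k ℤ.+ (v ℤ.+ + m ℤ.- + m)      ≡⟨ ≡.cong (λ i → + k ℤ.+ i) (ℤ.+-assoc v (+ m) (ℤ.- + m)) ⟩
      + k ℤ.+ (v ℤ.+ (+ m ℤ.- + m))    ≡⟨ ≡.cong (λ i → + k ℤ.+ (v ℤ.+ i)) (ℤ.+-inverseʳ (+ m)) ⟩
      + k ℤ.+ (v ℤ.+ 0ℤ)               ≡⟨ ≡.cong (λ i → + k ℤ.+ i) (ℤ.+-identityʳ v) ⟩
      + k ℤ.+ v                        ∎))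
      where open ≡.≡-Reasoning

    -- The new state of a site with neighbourhood b that draws the symbol s.
    update : Vec Q ρ → R → Q
    update b s = f b (Vec.map (λ _ → s) V′)

    V′-zero : ∀ {v} → v ∈ V′ → v ≡ 0ℤ
    V′-zero {v} = Equivalence.to (correlationFree v)

    globalMap-update : ∀ c s k →
      globalMap c s (+ k) ≡ update (neighbourhood (shift k (toStream c))) (s (+ k))
    globalMap-update c s k = ≡.cong₂ f (neighbourhood-toStream c k)
      (map-cong-∈ V′ λ v∈V′ → ≡.cong s
        (≡.trans (≡.cong (λ i → + k ℤ.+ i) (V′-zero v∈V′)) (ℤ.+-identityʳ (+ k))))

    -- The number of random symbols with which a site becomes a, that is, r
    -- times the probability of this event. The sequence d starts m positions
    -- to the left of the site.
    weight : Q → Stream q → ℕ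
    weight a d = length (filter (λ s → update (neighbourhood d) s Fin.≟ a) (allFin r))

    weight-local : ∀ a → Local M (weight a)
    weight-local a d~e =
      ≡.cong (λ b → length (filter (λ s → update b s Fin.≟ a) (allFin r))) (neighbourhood-local d~e)

    -- With the random symbols w, the sites at positions m, m + 1, … of d
    -- become u.
    Writes : ∀ {n} → Stream q → Vec Q n → Vec R n → Set
    Writes d u w = ∀ k → update (neighbourhood (shift (toℕ k) d)) (lookup w k) ≡ lookup u k

    writes? : ∀ {n} d (u : Vec Q n) → Decidable (Writes d u)
    writes? d u w = Fin.all? λ k → _ Fin.≟ lookup u k

    -- The product of the weights of the letters of u at the successive sites.
    wordWeight : ∀ {n} → Vec Q n → Stream q → ℕ
    wordWeight []      d = 1
    wordWeight (a ∷ u) d = weight a d * wordWeight u (tail d)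

    -- Distinct sites depend on distinct random symbols, so their weights
    -- multiply.
    count-writes : ∀ {n} (u : Vec Q n) d →
                   length (filter (writes? d u) (words r n)) ≡ wordWeight u d
    count-writes []      d = ≡.refl
    count-writes (a ∷ u) d = ≡.trans
      (length-filter-cartesianProductWith (λ s → _ Fin.≟ a) (writes? (tail d) u) (writes? d (a ∷ u))
        _∷_ (allFin r) (words r _)
        (λ s w → mk⇔ (λ writes → writes Fin.zero , writes ∘ Fin.suc)
                     (λ (first , rest) → λ { Fin.zero → first ; (Fin.suc k) → rest k })))
      (≡.cong (weight a d *_) (count-writes u (tail d)))

    module _ {a ℓ₁ ℓ₂} (K : ExactReals a ℓ₁ ℓ₂) where
      open ExactReals K using (_⁻¹) renaming (_*_ to _*ᴷ_)
      open OrderedField K using (ι)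

      law-weight : ∀ {n} c (u : Vec Q n) →
                   law F K c u 0ℤ ≡ ι (wordWeight u (toStream c)) *ᴷ ι (r ^ n) ⁻¹
      law-weight {n} c u = ≡.trans
        (uniform-count K (cylinderPreimage F c u 0ℤ) n width≡n start≡0 (writes? (toStream c) u)
          (λ s w s≡w →
            let eq = λ k → ≡.trans (globalMap-update c s (toℕ k)) (≡.cong (update _) (s≡w k))
            in mk⇔ (λ holds k → ≡.trans (≡.sym (eq k)) (holds k))
                   (λ writes k → ≡.trans (eq k) (writes k))))
        (≡.cong (λ N → ι N *ᴷ ι (r ^ n) ⁻¹) (count-writes u (toStream c)))
        where
        V′-width : maxAbs V′ ≡ 0
        V′-width = maxAbs-zero V′ V′-zero
        width≡n : maxAbs V′ + (n + maxAbs V′) ≡ n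
        width≡n = ≡.trans (≡.cong (λ m → m + (n + m)) V′-width) (ℕ.+-identityʳ n)
        start≡0 : 0ℤ ℤ.- + maxAbs V′ ≡ 0ℤ
        start≡0 = ≡.cong (λ m → 0ℤ ℤ.- + m) V′-width

-- The threshold problem.

open Patterns

theorem6p5 : ∀ {a ℓ₁ ℓ₂} (K : ExactReals a ℓ₁ ℓ₂) →
    let open ExactReals K in
    (I : PPTInput K) →
    let open PPTInput I in
    StochasticCA.CorrelationFree F →
    (α lam : Carrier) → 0# < α → lam < 1# →
    (∀ n → ϑ n ≈ α * lam ^ n) →
    Dec (PPT K I)
theorem6p5 K I correlationFree α lam 0<α lam<1 ϑ≈ =
  map′ (λ (d , n , 1≤n , exceeds) → fromStream d , n , 1≤n ,
          Equivalence.from (law-exceeds (fromStream d) n)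
            (<ι-respʳ (total-local n λ k _ → ≡.sym (toStream-fromStream d k)) exceeds))
       (λ (c , n , 1≤n , exceeds) → toStream c , n , 1≤n , Equivalence.to (law-exceeds c n) exceeds)
       (exceeding? x)
  where
  open PPTInput I
  open StochasticCA F using (r)
  open ExactReals K
  open OrderedField K
  open Algebra.Properties.CommutativeSemiring.Exp commutativeSemiring using (^-distrib-*)
  open Algebra.Solver.Ring.NaturalCoefficients.Default commutativeSemiring
    using (solve; _:*_; _:=_)
  open CorrelationFree F correlationFree
  open Weights (weight x) (weight y) (weight z) (weight-local x) (weight-local y) (weight-local z)

  -- Otherwise the threshold for n = 1 would be negative.
  0≤lam : 0# ≤ lam
  0≤lam = ≮⇒≥ λ lam<0 → ≤⇒≯ (0≤ϑ 1) (begin-strict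
    ϑ 1               ≈⟨ ϑ≈ 1 ⟩
    α * (lam * 1#)    ≈⟨ *-congˡ (*-identityʳ lam) ⟩
    α * lam           ≈⟨ *-comm α lam ⟩
    lam * α           <⟨ *-monoˡ-< 0<α lam<0 ⟩
    0# * α            ≈⟨ zeroˡ α ⟩
    0#                ∎)

  open Threshold K (α * (ι r * ι r)) (lam * ι r)
    (*-nonNeg (inj₁ 0<α) (*-nonNeg (ι-nonNeg r) (ι-nonNeg r)))
    (*-nonNeg 0≤lam (ι-nonNeg r))

  wordWeight-end : ∀ n d → wordWeight (Vec.replicate n y ∷ʳ z) d ≡ end n d
  wordWeight-end zero    d = ℕ.*-identityʳ (weight z d)
  wordWeight-end (suc n) d = ≡.cong (weight y d ℕ.*_) (wordWeight-end n (tail d))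

  -- The pattern x y ^ n z has n + 2 sites, each with r random symbols.
  scaled : ∀ n → ϑ n * ι (r ℕ.^ suc (suc n)) ≈ α * (ι r * ι r) * (lam * ι r) ^ n
  scaled n = begin-equality
    ϑ n * ι (r ℕ.^ suc (suc n))
      ≈⟨ *-cong (ϑ≈ n) (ι-^ r (suc (suc n))) ⟩
    α * lam ^ n * (ι r * (ι r * ι r ^ n))
      ≈⟨ solve 4 (λ α l r p → α :* l :* (r :* (r :* p)) := α :* (r :* r) :* (l :* p))
           refl α (lam ^ n) (ι r) (ι r ^ n) ⟩
    α * (ι r * ι r) * (lam ^ n * ι r ^ n)
      ≈⟨ *-congˡ (^-distrib-* lam (ι r) n) ⟨
    α * (ι r * ι r) * (lam * ι r) ^ n
      ∎

  law-exceeds : ∀ c n → ϑ n < law F K c (x ∷ (Vec.replicate n y ∷ʳ z)) 0ℤ ⇔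
                        Exceeds n (toStream c)
  law-exceeds c n = mk⇔
    (λ ϑ<law → <-respˡ (scaled n) (Equivalence.to scale (≡.subst (ϑ n <_) law≡ ϑ<law)))
    (λ exceeds → ≡.subst (ϑ n <_) (≡.sym law≡)
                   (Equivalence.from scale (<-respˡ (sym (scaled n)) exceeds)))
    where
    T = ι (total n (toStream c))
    scale : ϑ n < T * ι (r ℕ.^ suc (suc n)) ⁻¹ ⇔ ϑ n * ι (r ℕ.^ suc (suc n)) < T
    scale = <*⁻¹⇔*< (ι-pos (ℕ.m^n>0 r (suc (suc n))))
    law≡ : law F K c (x ∷ (Vec.replicate n y ∷ʳ z)) 0ℤ ≡ T * ι (r ℕ.^ suc (suc n)) ⁻¹
    law≡ = ≡.trans (law-weight K c (x ∷ (Vec.replicate n y ∷ʳ z)))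
      (≡.cong (λ w → ι (weight x (toStream c) ℕ.* w) * ι (r ℕ.^ suc (suc n)) ⁻¹)
              (wordWeight-end n (tail (toStream c))))
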